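{- For every positive integer $m$ there exist a finite alphabet $\Sigma$, two languages $K_m, L_m \subseteq \Sigma^\star$, and a sentence $\varphi_m \in \mathrm{FO}^2_m[<]$ such that $\varphi_m$ separates $K_m$ and $L_m$, but no $\psi \in \mathrm{FO}^2_{m-1}[<]$ separates $K_m$ and $L_m$.
   Context: Words $w=w_1\cdots w_{|w|}\in\Sigma^\star$ are structures with universe $\{1,\dots,|w|\}$, linear order $<$ and unary predicates $Q_{\mathtt a}=\{i:w_i=\mathtt a\}$, $\mathtt a\in\Sigma$. $\mathrm{FO}^2_{m,n}[<]$ is the set of first-order formulas over this vocabulary using only variables $x,y$ (which may be requantified) with quantifier depth at most $n$ and such that any path in the parse tree has at most $m$ blocks of alternating quantifiers; $\mathrm{FO}^2_m[<]=\bigcup_{n\ge m}\mathrm{FO}^2_{m,n}[<]$. A formula $\varphi$ separates $K,L\subseteq\Sigma^\star$ if either all $w\in K$ satisfy $\varphi$ and no $w\in L$ does, or vice versa. -}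

module Defs where

open import Data.Nat using (ℕ; zero; suc; _⊔_; _≤_; _∸_)
open import Data.Fin using (Fin)
open import Data.Fin.Base as F using ()
open import Data.List using (List; length; lookup)
open import Data.Bool using (Bool; true; false; T)
open import Data.Maybe using (Maybe; just; nothing)
open import Data.Product using (_×_; _,_; Σ)
open import Data.Sum using (_⊎_)
open import Data.Unit using (⊤; tt)
open import Data.Empty using (⊥)
open import Relation.Nullary using (¬_)
open import Relation.Binary.PropositionalEquality using (_≡_)

data Var : Set where
  vx vy : Var

record Scope : Set where
  constructor ⟨_,_⟩
  field
    xb yb : Bool

Bound : Scope → Var → Set
Bound s vx = T (Scope.xb s)
Bound s vy = T (Scope.yb s)

bind : Var → Scope → Scope
bind vx ⟨ _ , b ⟩ = ⟨ true , b ⟩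
bind vy ⟨ a , _ ⟩ = ⟨ a , true ⟩

data FO2 (k : ℕ) : Scope → Set where
  tt′  : ∀ {s} → FO2 k s
  ff′  : ∀ {s} → FO2 k s
  lab  : ∀ {s} (a : Fin k) (v : Var) → Bound s v → FO2 k s
  lt   : ∀ {s} (u v : Var) → Bound s u → Bound s v → FO2 k s
  eq   : ∀ {s} (u v : Var) → Bound s u → Bound s v → FO2 k s
  neg  : ∀ {s} → FO2 k s → FO2 k s
  and  : ∀ {s} → FO2 k s → FO2 k s → FO2 k s
  or   : ∀ {s} → FO2 k s → FO2 k s → FO2 k s
  ex   : ∀ {s} (v : Var) → FO2 k (bind v s) → FO2 k s
  all  : ∀ {s} (v : Var) → FO2 k (bind v s) → FO2 k s

Sentence : ℕ → Set
Sentence k = FO2 k ⟨ false , false ⟩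

Word : ℕ → Set
Word k = List (Fin k)

Lang : ℕ → Set₁
Lang k = Word k → Set

Env : ∀ {k} → Word k → Scope → Set
Env w s = ((Bound s vx) → Fin (length w)) × ((Bound s vy) → Fin (length w))

get : ∀ {k} (w : Word k) {s} → Env w s → (v : Var) → Bound s v → Fin (length w)
get w (ρx , ρy) vx b = ρx b
get w (ρx , ρy) vy b = ρy b

set : ∀ {k} (w : Word k) {s} → Env w s → (v : Var) → Fin (length w) → Env w (bind v s)
set w (ρx , ρy) vx i = (λ _ → i) , ρy
set w (ρx , ρy) vy i = ρx , (λ _ → i)

Sat : ∀ {k s} (w : Word k) → Env w s → FO2 k s → Set
Sat w ρ tt′ = ⊤
Sat w ρ ff′ = ⊥
Sat w ρ (lab a v b) = lookup w (get w ρ v b) ≡ a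
Sat w ρ (lt u v bu bv) = get w ρ u bu F.< get w ρ v bv
Sat w ρ (eq u v bu bv) = get w ρ u bu ≡ get w ρ v bv
Sat w ρ (neg φ) = ¬ Sat w ρ φ
Sat w ρ (and φ ψ) = Sat w ρ φ × Sat w ρ ψ
Sat w ρ (or φ ψ) = Sat w ρ φ ⊎ Sat w ρ ψ
Sat w ρ (ex v φ) = Σ (Fin (length w)) λ i → Sat w (set w ρ v i) φ
Sat w ρ (all v φ) = (i : Fin (length w)) → Sat w (set w ρ v i) φ

emptyEnv : ∀ {k} (w : Word k) → Env w ⟨ false , false ⟩
emptyEnv w = (λ ()) , (λ ())

_⊨_ : ∀ {k} → Word k → Sentence k → Set
w ⊨ φ = Sat w (emptyEnv w) φ

-- Quantifier alternation.  A quantifier under an odd number of negations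
-- acts as its dual; 'true' = existential (effective) block, 'false' = universal.
-- blk pol prev φ = maximal number of quantifier blocks on a path of φ,
-- where pol is the current polarity (true = even number of negations) and
-- prev the effective kind of the last quantifier above (nothing if none).
newBlock : Maybe Bool → Bool → ℕ
newBlock nothing      _     = 1
newBlock (just true)  true  = 0
newBlock (just false) false = 0
newBlock (just true)  false = 1
newBlock (just false) true  = 1

flip : Bool → Bool
flip true = false
flip false = true

blk : ∀ {k s} → Bool → Maybe Bool → FO2 k s → ℕ
blk p q tt′ = 0
blk p q ff′ = 0
blk p q (lab _ _ _) = 0
blk p q (lt _ _ _ _) = 0
blk p q (eq _ _ _ _) = 0
blk p q (neg φ) = blk (flip p) q φ
blk p q (and φ ψ) = blk p q φ ⊔ blk p q ψ
blk p q (or φ ψ) = blk p q φ ⊔ blk p q ψ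
blk true  q (ex _ φ) = newBlock q true + blk true (just true) φ
  where open Data.Nat using (_+_)
blk false q (ex _ φ) = newBlock q false + blk false (just false) φ
  where open Data.Nat using (_+_)
blk true  q (all _ φ) = newBlock q false + blk true (just false) φ
  where open Data.Nat using (_+_)
blk false q (all _ φ) = newBlock q true + blk false (just true) φ
  where open Data.Nat using (_+_)

blocks : ∀ {k s} → FO2 k s → ℕ
blocks = blk true nothing

-- φ ∈ FO²_m[<]  (= ⋃_n FO²_{m,n}[<]: quantifier depth unrestricted)
InFO2 : ∀ {k s} → ℕ → FO2 k s → Set
InFO2 m φ = blocks φ ≤ m

Separates : ∀ {k} → Sentence k → Lang k → Lang k → Set
Separates φ K L =
  ((∀ w → K w → w ⊨ φ) × (∀ w → L w → ¬ (w ⊨ φ)))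
  ⊎ ((∀ w → L w → w ⊨ φ) × (∀ w → K w → ¬ (w ⊨ φ)))

{-# OPTIONS --safe #-}
module Submission where

-- Starting from the empty word and a one-letter word, replace u repeatedly by (W c)ᴺ u (d W)ᴺ, where c and d are
-- fresh letters and W lists the letters available so far.  The middle factor u is definable by one universal block
-- (no c at or after x, no d at or before x), so relativising "there is a position" to it m - 1 times yields a
-- sentence with m blocks.  Conversely, if u and v agree on sentences with p blocks, then the padded words
-- agree on sentences with p + 1 blocks as long as the depth is below N: for the first p blocks Duplicator copies
-- moves in the padding and plays the old game in the middle, and in the last block every middle position
-- sees all short subwords on both sides, so its letter alone matters and can be found in the padding.

open import Defs
open import Data.Bool using (Bool; true; false)
open import Data.Empty using (⊥; ⊥-elim)
open import Data.Fin using (Fin; zero; suc; toℕ; fromℕ<)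
import Data.Fin as Fin
import Data.Fin.Properties as Fin
open import Data.List using (List; []; _∷_; _++_; [_]; map; length; lookup; reverse; allFin; cartesianProduct)
open import Data.List.Membership.Propositional using (_∈_)
open import Data.List.Membership.Propositional.Properties using (∈-map⁺; ∈-++⁺ˡ; ∈-++⁺ʳ; ∈-allFin; ∈-cartesianProduct⁺)
open import Data.List.Properties using (unfold-reverse)
open import Data.List.Relation.Unary.All as All using (All; []; _∷_)
import Data.List.Relation.Unary.All.Properties as All
open import Data.List.Relation.Unary.AllPairs as AllPairs using (AllPairs; []; _∷_)
import Data.List.Relation.Unary.AllPairs.Properties as AllPairs
open import Data.List.Relation.Unary.Any using (here; there)
import Data.List.Relation.Unary.Any.Properties as Any
open import Data.Maybe using (just; nothing)
open import Data.Nat using (ℕ; zero; suc; _+_; _⊔_; _≤_; _<_; _∸_; z≤n; s≤s)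
open import Data.Nat.Properties using (≤-refl; ≤-trans; ≤-reflexive; <-trans; <-asym; <-irrefl; n≤1+n; ⊔-lub; ⊔-mono-≤; m⊔n≤o⇒m≤o; m⊔n≤o⇒n≤o; +-monoʳ-≤; +-suc; m≤m+n; _<?_; ≮⇒≥)
open import Data.Product using (Σ; ∃; _×_; _,_; proj₁; proj₂)
open import Data.Product.Relation.Binary.Lex.Strict using (×-Lex)
open import Data.Sum using (_⊎_; inj₁; inj₂)
open import Data.Unit using (⊤; tt)
open import Relation.Binary.Definitions using (tri<; tri≈; tri>)
open import Relation.Binary.PropositionalEquality using (_≡_; refl; sym; trans; cong; cong₂; subst; setoid)
open import Relation.Nullary using (¬_; yes; no)

-- Finite labelled linear orders with two directions

data Side : Set where
  left right : Side

opposite : Side → Side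
opposite left  = right
opposite right = left

opposite-involutive : ∀ e → opposite (opposite e) ≡ e
opposite-involutive left  = refl
opposite-involutive right = refl

-- x ≺[ e ] y means that y lies on side e of x.
record Model (k : ℕ) : Set₁ where
  field
    Carrier   : Set
    _≺[_]_    : Carrier → Side → Carrier → Set
    label     : Carrier → Fin k
    reflect   : ∀ {e x y} → x ≺[ e ] y → y ≺[ opposite e ] x
    exclusive : ∀ {x y} → x ≺[ left ] y → ¬ (x ≺[ right ] y)
    compare   : ∀ x y → x ≡ y ⊎ ∃ λ e → x ≺[ e ] y
    elements  : List Carrier
    ascending : AllPairs _≺[ right ]_ elements
    complete  : ∀ x → x ∈ elements

  irreflexive : ∀ {e x} → ¬ (x ≺[ e ] x)
  irreflexive {left}  x≺x = exclusive x≺x (reflect x≺x)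
  irreflexive {right} x≺x = exclusive (reflect x≺x) x≺x

  side-unique : ∀ {e f x y} → x ≺[ e ] y → x ≺[ f ] y → e ≡ f
  side-unique {left}  {left}  p q = refl
  side-unique {left}  {right} p q = ⊥-elim (exclusive p q)
  side-unique {right} {left}  p q = ⊥-elim (exclusive q p)
  side-unique {right} {right} p q = refl

open Model

-- Satisfaction in models

other : Var → Var
other vx = vy
other vy = vx

bound-new : ∀ v {s} → Bound (bind v s) v
bound-new vx = tt
bound-new vy = tt

bound-old : ∀ u {s} v → Bound s v → Bound (bind u s) v
bound-old vx vx b = tt
bound-old vx vy b = b
bound-old vy vx b = b
bound-old vy vy b = tt

Assignment : ∀ {k} → Model k → Scope → Set
Assignment S s = ∀ v → Bound s v → Carrier S

update : ∀ {k} (S : Model k) {s} → Assignment S s → ∀ v → Carrier S → Assignment S (bind v s)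
update S ρ vx x vx b = x
update S ρ vx x vy b = ρ vy b
update S ρ vy x vx b = ρ vx b
update S ρ vy x vy b = x

Holds : ∀ {k s} (S : Model k) → Assignment S s → FO2 k s → Set
Holds S ρ tt′            = ⊤
Holds S ρ ff′            = ⊥
Holds S ρ (lab a v b)    = label S (ρ v b) ≡ a
Holds S ρ (lt u v bu bv) = _≺[_]_ S (ρ u bu) right (ρ v bv)
Holds S ρ (eq u v bu bv) = ρ u bu ≡ ρ v bv
Holds S ρ (neg φ)        = ¬ Holds S ρ φ
Holds S ρ (and φ ψ)      = Holds S ρ φ × Holds S ρ ψ
Holds S ρ (or φ ψ)       = Holds S ρ φ ⊎ Holds S ρ ψ
Holds S ρ (ex v φ)       = Σ (Carrier S) λ x → Holds S (update S ρ v x) φ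
Holds S ρ (all v φ)      = ∀ x → Holds S (update S ρ v x) φ

noVars : ∀ {k} (S : Model k) → Assignment S ⟨ false , false ⟩
noVars S vx ()
noVars S vy ()

_⊩_ : ∀ {k} → Model k → Sentence k → Set
S ⊩ φ = Holds S (noVars S) φ

-- The word of a model

module _ {A : Set} {k : ℕ} (f : A → Fin k) where

  at : (xs : List A) → Fin (length (map f xs)) → A
  at (x ∷ xs) zero    = x
  at (x ∷ xs) (suc i) = at xs i

  lookup-at : ∀ xs i → lookup (map f xs) i ≡ f (at xs i)
  lookup-at (x ∷ xs) zero    = refl
  lookup-at (x ∷ xs) (suc i) = lookup-at xs i

  at-surjective : ∀ xs {x} → x ∈ xs → ∃ λ i → at xs i ≡ x
  at-surjective (x ∷ xs) (here refl) = zero , refl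
  at-surjective (x ∷ xs) (there x∈)  = let i , p = at-surjective xs x∈ in suc i , p

  All-at : ∀ {P : A → Set} {xs} → All P xs → ∀ i → P (at xs i)
  All-at (p ∷ ps) zero    = p
  All-at (p ∷ ps) (suc i) = All-at ps i

  at-mono : ∀ {R : A → A → Set} {xs} → AllPairs R xs → ∀ {i j} → i Fin.< j → R (at xs i) (at xs j)
  at-mono (p ∷ ps) {zero}  {suc j} i<j       = All-at p j
  at-mono (p ∷ ps) {suc i} {suc j} (s≤s i<j) = at-mono ps i<j

word : ∀ {k} → Model k → Word k
word S = map (label S) (elements S)

module _ {k : ℕ} (S : Model k) where

  private
    position : Fin (length (word S)) → Carrier S
    position = at (label S) (elements S)

    position-mono : ∀ {i j} → i Fin.< j → _≺[_]_ S (position i) right (position j)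
    position-mono = at-mono (label S) (ascending S)

    -- Indices are linearly ordered and `position` is monotone, so each wrong case of the comparison
    -- gives an order in `S` that contradicts `p`.
    position-reflects-≺ : ∀ i j → _≺[_]_ S (position i) right (position j) → i Fin.< j
    position-reflects-≺ i j p with Fin.<-cmp i j
    ... | tri< i<j _ _  = i<j
    ... | tri≈ _ refl _ = ⊥-elim (irreflexive S p)
    ... | tri> _ _ j<i  = ⊥-elim (exclusive S (reflect S (position-mono j<i)) p)

    position-injective : ∀ i j → position i ≡ position j → i ≡ j
    position-injective i j p with Fin.<-cmp i j
    ... | tri< i<j _ _ = ⊥-elim (irreflexive S (subst (λ x → _≺[_]_ S x right (position j)) p (position-mono i<j)))
    ... | tri≈ _ i≡j _ = i≡j
    ... | tri> _ _ j<i = ⊥-elim (irreflexive S (subst (λ x → _≺[_]_ S (position j) right x) p (position-mono j<i)))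

    Tracks : ∀ {s} → Env (word S) s → Assignment S s → Set
    Tracks ρ σ = ∀ v b → position (get (word S) ρ v b) ≡ σ v b

    tracks-set : ∀ {s} {ρ : Env (word S) s} {σ : Assignment S s} → Tracks ρ σ →
                 ∀ v {i x} → position i ≡ x → Tracks (set (word S) ρ v i) (update S σ v x)
    tracks-set t vx p vx b = p
    tracks-set t vx p vy b = t vy b
    tracks-set t vy p vx b = t vx b
    tracks-set t vy p vy b = p

  mutual
    -- Negation exchanges the two directions, so they are proved together. Quantifiers go through
    -- because `complete` gives every element of `S` an index.
    Sat⇒Holds : ∀ {s} {ρ : Env (word S) s} {σ : Assignment S s} → Tracks ρ σ →
                ∀ φ → Sat (word S) ρ φ → Holds S σ φ
    Sat⇒Holds t tt′ h = h
    Sat⇒Holds {ρ = ρ} t (lab a v b) h =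
      trans (cong (label S) (sym (t v b))) (trans (sym (lookup-at (label S) (elements S) (get (word S) ρ v b))) h)
    Sat⇒Holds t (lt u v bu bv) h rewrite sym (t u bu) | sym (t v bv) = position-mono h
    Sat⇒Holds t (eq u v bu bv) h = trans (sym (t u bu)) (trans (cong position h) (t v bv))
    Sat⇒Holds t (neg φ) h h′ = h (Holds⇒Sat t φ h′)
    Sat⇒Holds t (and φ ψ) (h , h′) = Sat⇒Holds t φ h , Sat⇒Holds t ψ h′
    Sat⇒Holds t (or φ ψ) (inj₁ h) = inj₁ (Sat⇒Holds t φ h)
    Sat⇒Holds t (or φ ψ) (inj₂ h) = inj₂ (Sat⇒Holds t ψ h)
    Sat⇒Holds {ρ = ρ} t (ex v φ) (i , h) = position i , Sat⇒Holds (tracks-set {ρ = ρ} t v refl) φ h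
    Sat⇒Holds {ρ = ρ} t (all v φ) h x =
      let i , p = at-surjective (label S) (elements S) (complete S x)
      in Sat⇒Holds (tracks-set {ρ = ρ} t v p) φ (h i)

    Holds⇒Sat : ∀ {s} {ρ : Env (word S) s} {σ : Assignment S s} → Tracks ρ σ →
                ∀ φ → Holds S σ φ → Sat (word S) ρ φ
    Holds⇒Sat t tt′ h = h
    Holds⇒Sat {ρ = ρ} t (lab a v b) h =
      trans (lookup-at (label S) (elements S) (get (word S) ρ v b)) (trans (cong (label S) (t v b)) h)
    Holds⇒Sat t (lt u v bu bv) h rewrite sym (t u bu) | sym (t v bv) = position-reflects-≺ _ _ h
    Holds⇒Sat t (eq u v bu bv) h = position-injective _ _ (trans (t u bu) (trans h (sym (t v bv))))
    Holds⇒Sat t (neg φ) h h′ = h (Sat⇒Holds t φ h′)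
    Holds⇒Sat t (and φ ψ) (h , h′) = Holds⇒Sat t φ h , Holds⇒Sat t ψ h′
    Holds⇒Sat t (or φ ψ) (inj₁ h) = inj₁ (Holds⇒Sat t φ h)
    Holds⇒Sat t (or φ ψ) (inj₂ h) = inj₂ (Holds⇒Sat t ψ h)
    Holds⇒Sat {ρ = ρ} t (ex v φ) (x , h) =
      let i , p = at-surjective (label S) (elements S) (complete S x)
      in i , Holds⇒Sat (tracks-set {ρ = ρ} t v p) φ h
    Holds⇒Sat {ρ = ρ} t (all v φ) h i = Holds⇒Sat (tracks-set {ρ = ρ} t v refl) φ (h (position i))

  ⊨⇒⊩ : ∀ φ → word S ⊨ φ → S ⊩ φ
  ⊨⇒⊩ = Sat⇒Holds λ { vx () ; vy () }

  ⊩⇒⊨ : ∀ φ → S ⊩ φ → word S ⊨ φ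
  ⊩⇒⊨ = Holds⇒Sat λ { vx () ; vy () }

-- The simulation game

-- Spoiler moves one pebble in S, Duplicator answers in T; p bounds the number of quantifier
-- blocks (the roles of S and T are exchanged at each alternation) and n the number of moves per block.
Simulates : ∀ {k} → ℕ → ℕ → (S T : Model k) → Carrier S → Carrier T → Set
Simulates zero    n       S T x y = label S x ≡ label T y
Simulates (suc p) zero    S T x y = Simulates p zero T S y x
Simulates (suc p) (suc n) S T x y =
  (∀ e x′ → _≺[_]_ S x e x′ → Σ (Carrier T) λ y′ → _≺[_]_ T y e y′ × Simulates (suc p) n S T x′ y′)
  × Simulates p (suc n) T S y x

-- The opening move, made while no pebble lies on the board: Spoiler may choose any position, and
-- `n` moves remain after it. With no blocks at all, any two models are equivalent, even an empty
-- and a nonempty one.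
GloballySimulates : ∀ {k} → ℕ → ℕ → (S T : Model k) → Set
GloballySimulates zero    n S T = ⊤
GloballySimulates (suc p) n S T =
  (∀ x → Σ (Carrier T) λ y → Simulates (suc p) n S T x y) × GloballySimulates p n T S

module _ {k : ℕ} where

  simulates-swap : ∀ p n (S T : Model k) {x y} → Simulates (suc p) n S T x y → Simulates p n T S y x
  simulates-swap p zero    S T h       = h
  simulates-swap p (suc n) S T (_ , h) = h

  simulates-pred : ∀ p n (S T : Model k) {x y} → Simulates p (suc n) S T x y → Simulates p n S T x y
  simulates-pred zero    n       S T h       = h
  simulates-pred (suc p) zero    S T (_ , h) = simulates-pred p zero T S h
  simulates-pred (suc p) (suc n) S T (f , h) =
    (λ e x′ x≺x′ → let y′ , y≺y′ , h′ = f e x′ x≺x′ in y′ , y≺y′ , simulates-pred (suc p) n S T h′)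
    , simulates-pred p (suc n) T S h

  globally-pred : ∀ p n (S T : Model k) → GloballySimulates p (suc n) S T → GloballySimulates p n S T
  globally-pred zero    n S T h       = tt
  globally-pred (suc p) n S T (f , h) =
    (λ x → let y , h′ = f x in y , simulates-pred (suc p) n S T h′) , globally-pred p n T S h

  simulates-label : ∀ p n (S T : Model k) {x y} → Simulates p n S T x y → label S x ≡ label T y
  simulates-label zero    n S T h = h
  simulates-label (suc p) n S T h = sym (simulates-label p n T S (simulates-swap p n S T h))

-- Preservation of formulas by the game

depth : ∀ {k s} → FO2 k s → ℕ
depth tt′            = 0
depth ff′            = 0
depth (lab _ _ _)    = 0
depth (lt _ _ _ _)   = 0
depth (eq _ _ _ _)   = 0
depth (neg φ)        = depth φ
depth (and φ ψ)      = depth φ ⊔ depth ψ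
depth (or φ ψ)       = depth φ ⊔ depth ψ
depth (ex _ φ)       = suc (depth φ)
depth (all _ φ)      = suc (depth φ)

-- Changing the polarity dualises every quantifier below; if the preceding kind is dualised too, the
-- alternations stay where they were. This lets `preserve` assume throughout that the current block
-- has kind `true`.
blk-dual : ∀ {k s} pol q (φ : FO2 k s) → blk pol (just q) φ ≡ blk (flip pol) (just (flip q)) φ
blk-dual pol q tt′            = refl
blk-dual pol q ff′            = refl
blk-dual pol q (lab _ _ _)    = refl
blk-dual pol q (lt _ _ _ _)   = refl
blk-dual pol q (eq _ _ _ _)   = refl
blk-dual pol q (neg φ)        = blk-dual (flip pol) q φ
blk-dual pol q (and φ ψ)      = cong₂ _⊔_ (blk-dual pol q φ) (blk-dual pol q ψ)
blk-dual pol q (or φ ψ)       = cong₂ _⊔_ (blk-dual pol q φ) (blk-dual pol q ψ)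
blk-dual true  true  (ex _ φ)  = blk-dual true true φ
blk-dual true  false (ex _ φ)  = cong suc (blk-dual true true φ)
blk-dual false true  (ex _ φ)  = cong suc (blk-dual false false φ)
blk-dual false false (ex _ φ)  = blk-dual false false φ
blk-dual true  true  (all _ φ) = cong suc (blk-dual true false φ)
blk-dual true  false (all _ φ) = blk-dual true false φ
blk-dual false true  (all _ φ) = blk-dual false true φ
blk-dual false false (all _ φ) = cong suc (blk-dual false true φ)

-- Under an odd number of negations truth has to travel backwards, from `T` to `S`.
Transfer : Bool → Set → Set → Set
Transfer true  A B = A → B
Transfer false A B = B → A

transfer : ∀ pol {A B : Set} → (A → B) → (B → A) → Transfer pol A B
transfer true  f g = f
transfer false f g = g

module _ {k : ℕ} where

  data SameOrder (S T : Model k) (x x′ : Carrier S) (y y′ : Carrier T) : Set where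
    same  : x ≡ x′ → y ≡ y′ → SameOrder S T x x′ y y′
    apart : ∀ e → _≺[_]_ S x e x′ → _≺[_]_ T y e y′ → SameOrder S T x x′ y y′

  module _ {S T : Model k} where

    sameOrder-sym : ∀ {x x′ y y′} → SameOrder S T x x′ y y′ → SameOrder T S y y′ x x′
    sameOrder-sym (same p q)    = same q p
    sameOrder-sym (apart e p q) = apart e q p

    sameOrder-reverse : ∀ {x x′ y y′} → SameOrder S T x x′ y y′ → SameOrder S T x′ x y′ y
    sameOrder-reverse (same p q)    = same (sym p) (sym q)
    sameOrder-reverse (apart e p q) = apart (opposite e) (reflect S p) (reflect T q)

    sameOrder-≡ : ∀ {x x′ y y′} → SameOrder S T x x′ y y′ → x ≡ x′ → y ≡ y′
    sameOrder-≡ (same _ q)    p    = q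
    sameOrder-≡ (apart _ r _) refl = ⊥-elim (irreflexive S r)

    sameOrder-≺ : ∀ {e x x′ y y′} → SameOrder S T x x′ y y′ → _≺[_]_ S x e x′ → _≺[_]_ T y e y′
    sameOrder-≺ (same refl q) p = ⊥-elim (irreflexive S p)
    sameOrder-≺ (apart f r q) p rewrite side-unique S p r = q

  -- This is where two variables enter: a move lifts one pebble and is judged against the other one
  -- only. Hence each pebble pair carries its own game, and the pairs are tied together by nothing
  -- more than their order type.
  record Linked (p n : ℕ) (S T : Model k) {s : Scope} (ρ : Assignment S s) (σ : Assignment T s) : Set where
    field
      pebbles : ∀ v b → Simulates p n S T (ρ v b) (σ v b)
      order   : ∀ u v bu bv → SameOrder S T (ρ u bu) (ρ v bv) (σ u bu) (σ v bv)
  open Linked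

  linked-swap : ∀ {p n S T s} {ρ : Assignment S s} {σ : Assignment T s} →
                Linked (suc p) n S T ρ σ → Linked p n T S σ ρ
  linked-swap {p} {n} {S} {T} l .pebbles v b = simulates-swap p n S T (pebbles l v b)
  linked-swap l .order u v bu bv = sameOrder-sym (order l u v bu bv)

  linked-update : ∀ {p n S T s} {ρ : Assignment S s} {σ : Assignment T s} → Linked p (suc n) S T ρ σ →
                  ∀ v {x y} → Simulates p n S T x y →
                  (∀ b → SameOrder S T (ρ (other v) b) x (σ (other v) b) y) →
                  Linked p n S T (update S ρ v x) (update T σ v y)
  linked-update l vx h o .pebbles vx b = h
  linked-update {p} {n} {S} {T} l vx h o .pebbles vy b = simulates-pred p n S T (pebbles l vy b)
  linked-update {p} {n} {S} {T} l vy h o .pebbles vx b = simulates-pred p n S T (pebbles l vx b)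
  linked-update l vy h o .pebbles vy b = h
  linked-update l vx h o .order vx vx bu bv = same refl refl
  linked-update l vx h o .order vx vy bu bv = sameOrder-reverse (o bv)
  linked-update l vx h o .order vy vx bu bv = o bu
  linked-update l vx h o .order vy vy bu bv = order l vy vy bu bv
  linked-update l vy h o .order vx vx bu bv = order l vx vx bu bv
  linked-update l vy h o .order vx vy bu bv = o bu
  linked-update l vy h o .order vy vx bu bv = sameOrder-reverse (o bv)
  linked-update l vy h o .order vy vy bu bv = same refl refl

  -- A move in `Simulates` has a direction. A new pebble placed on top of the remaining one has
  -- none, and Duplicator answers it by doing the same.
  answer : ∀ p n (S T : Model k) {x y} → Simulates (suc p) (suc n) S T x y → ∀ x′ →
           Σ (Carrier T) λ y′ → Simulates (suc p) n S T x′ y′ × SameOrder S T x x′ y y′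
  answer p n S T {x} {y} h x′ with compare S x x′
  ... | inj₁ refl       = y , simulates-pred (suc p) n S T h , same refl refl
  ... | inj₂ (e , x≺x′) = let y′ , y≺y′ , h′ = proj₁ h e x′ x≺x′ in y′ , h′ , apart e x≺x′ y≺y′

  -- If the other pebble is on the board, the reply is found relative to it; otherwise the move
  -- counts as an opening one and the global game answers it.
  respond : ∀ p n S T {s} {ρ : Assignment S s} {σ : Assignment T s} → Linked (suc p) (suc n) S T ρ σ →
            GloballySimulates (suc p) (suc n) S T → ∀ v x →
            Σ (Carrier T) λ y → Linked (suc p) n S T (update S ρ v x) (update T σ v y)
  respond p n S T {⟨ _ , true ⟩} l g vx x =
    let y , h , o = answer p n S T (pebbles l vy tt) x in y , linked-update l vx h (λ _ → o)
  respond p n S T {⟨ true , _ ⟩} l g vy x =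
    let y , h , o = answer p n S T (pebbles l vx tt) x in y , linked-update l vy h (λ _ → o)
  respond p n S T {⟨ _ , false ⟩} l (g , _) vx x =
    let y , h = g x in y , linked-update l vx (simulates-pred (suc p) n S T h) (λ ())
  respond p n S T {⟨ false , _ ⟩} l (g , _) vy x =
    let y , h = g x in y , linked-update l vy (simulates-pred (suc p) n S T h) (λ ())

  -- Spoiler is inside a block played in `S`, with `p` alternations to come. A quantifier of
  -- effective kind `true` is a move in `S` and continues the block; one of kind `false` is a move
  -- in `T`, so the models are exchanged and an alternation is spent.
  preserve : ∀ {s} (φ : FO2 k s) pol p n S T {ρ : Assignment S s} {σ : Assignment T s} →
             Linked (suc p) n S T ρ σ → GloballySimulates (suc p) n S T →
             depth φ ≤ n → blk pol (just true) φ ≤ p → Transfer pol (Holds S ρ φ) (Holds T σ φ)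
  preserve tt′ pol p n S T l g d≤ b≤ = transfer pol (λ h → h) (λ h → h)
  preserve ff′ pol p n S T l g d≤ b≤ = transfer pol (λ h → h) (λ h → h)
  preserve (lab a v b) pol p n S T l g d≤ b≤ =
    transfer pol (trans (sym x≈y)) (trans x≈y)
    where x≈y = simulates-label (suc p) n S T (pebbles l v b)
  preserve (lt u v bu bv) pol p n S T l g d≤ b≤ =
    transfer pol (sameOrder-≺ (order l u v bu bv)) (sameOrder-≺ (sameOrder-sym (order l u v bu bv)))
  preserve (eq u v bu bv) pol p n S T l g d≤ b≤ =
    transfer pol (sameOrder-≡ (order l u v bu bv)) (sameOrder-≡ (sameOrder-sym (order l u v bu bv)))
  preserve (neg φ) true p n S T l g d≤ b≤ h h′ = h (preserve φ false p n S T l g d≤ b≤ h′)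
  preserve (neg φ) false p n S T l g d≤ b≤ h h′ = h (preserve φ true p n S T l g d≤ b≤ h′)
  preserve (and φ ψ) true p n S T l g d≤ b≤ (h , h′) =
    preserve φ true p n S T l g (m⊔n≤o⇒m≤o _ _ d≤) (m⊔n≤o⇒m≤o _ _ b≤) h ,
    preserve ψ true p n S T l g (m⊔n≤o⇒n≤o (depth φ) _ d≤) (m⊔n≤o⇒n≤o (blk true (just true) φ) _ b≤) h′
  preserve (and φ ψ) false p n S T l g d≤ b≤ (h , h′) =
    preserve φ false p n S T l g (m⊔n≤o⇒m≤o _ _ d≤) (m⊔n≤o⇒m≤o _ _ b≤) h ,
    preserve ψ false p n S T l g (m⊔n≤o⇒n≤o (depth φ) _ d≤) (m⊔n≤o⇒n≤o (blk false (just true) φ) _ b≤) h′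
  preserve (or φ ψ) true p n S T l g d≤ b≤ (inj₁ h) =
    inj₁ (preserve φ true p n S T l g (m⊔n≤o⇒m≤o _ _ d≤) (m⊔n≤o⇒m≤o _ _ b≤) h)
  preserve (or φ ψ) true p n S T l g d≤ b≤ (inj₂ h) =
    inj₂ (preserve ψ true p n S T l g (m⊔n≤o⇒n≤o (depth φ) _ d≤) (m⊔n≤o⇒n≤o (blk true (just true) φ) _ b≤) h)
  preserve (or φ ψ) false p n S T l g d≤ b≤ (inj₁ h) =
    inj₁ (preserve φ false p n S T l g (m⊔n≤o⇒m≤o _ _ d≤) (m⊔n≤o⇒m≤o _ _ b≤) h)
  preserve (or φ ψ) false p n S T l g d≤ b≤ (inj₂ h) =
    inj₂ (preserve ψ false p n S T l g (m⊔n≤o⇒n≤o (depth φ) _ d≤) (m⊔n≤o⇒n≤o (blk false (just true) φ) _ b≤) h)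
  preserve (ex v φ) true p (suc n) S T l g (s≤s d≤) b≤ (x , h) =
    let y , l′ = respond p n S T l g v x
    in y , preserve φ true p n S T l′ (globally-pred (suc p) n S T g) d≤ b≤ h
  -- After the exchange of `S` and `T` the same implication is read with the opposite polarity, and
  -- `blk-dual` adjusts the block count.
  preserve (ex v φ) false (suc p) (suc n) S T l (_ , g) (s≤s d≤) (s≤s b≤) (y , h) =
    let x , l′ = respond p n T S (linked-swap l) g v y
    in x , preserve φ true p n T S l′ (globally-pred (suc p) n T S g) d≤ (subst (_≤ p) (blk-dual false false φ) b≤) h
  preserve (all v φ) true (suc p) (suc n) S T l (_ , g) (s≤s d≤) (s≤s b≤) h y =
    let x , l′ = respond p n T S (linked-swap l) g v y
    in preserve φ false p n T S l′ (globally-pred (suc p) n T S g) d≤ (subst (_≤ p) (blk-dual true false φ) b≤) (h x)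
  preserve (all v φ) false p (suc n) S T l g (s≤s d≤) b≤ h x =
    let y , l′ = respond p n S T l g v x
    in preserve φ false p n S T l′ (globally-pred (suc p) n S T g) d≤ b≤ (h y)

  noVars-linked : ∀ p n S T → Linked p n S T (noVars S) (noVars T)
  noVars-linked p n S T .pebbles vx ()
  noVars-linked p n S T .pebbles vy ()
  noVars-linked p n S T .order vx v ()
  noVars-linked p n S T .order vy v ()

  -- Before the first quantifier the leading block can be of either kind, so the game is needed in
  -- both directions. The first quantifier pays for its block here; `preserve` then meets it again
  -- as a continuation of that block, at no cost.
  preserve-sentence : (φ : Sentence k) → ∀ pol p n S T → GloballySimulates p n S T → GloballySimulates p n T S →
                      depth φ ≤ n → blk pol nothing φ ≤ p → S ⊩ φ → T ⊩ φ
  preserve-sentence tt′ pol p n S T g g′ d≤ b≤ h = h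
  preserve-sentence (lab a vx ()) pol p n S T g g′ d≤ b≤ h
  preserve-sentence (lab a vy ()) pol p n S T g g′ d≤ b≤ h
  preserve-sentence (lt vx v () bv) pol p n S T g g′ d≤ b≤ h
  preserve-sentence (lt vy v () bv) pol p n S T g g′ d≤ b≤ h
  preserve-sentence (eq vx v () bv) pol p n S T g g′ d≤ b≤ h
  preserve-sentence (eq vy v () bv) pol p n S T g g′ d≤ b≤ h
  preserve-sentence (neg φ) pol p n S T g g′ d≤ b≤ h h′ =
    h (preserve-sentence φ (flip pol) p n T S g′ g d≤ b≤ h′)
  preserve-sentence (and φ ψ) pol p n S T g g′ d≤ b≤ (h , h′) =
    preserve-sentence φ pol p n S T g g′ (m⊔n≤o⇒m≤o _ _ d≤) (m⊔n≤o⇒m≤o _ _ b≤) h ,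
    preserve-sentence ψ pol p n S T g g′ (m⊔n≤o⇒n≤o (depth φ) _ d≤) (m⊔n≤o⇒n≤o (blk pol nothing φ) _ b≤) h′
  preserve-sentence (or φ ψ) pol p n S T g g′ d≤ b≤ (inj₁ h) =
    inj₁ (preserve-sentence φ pol p n S T g g′ (m⊔n≤o⇒m≤o _ _ d≤) (m⊔n≤o⇒m≤o _ _ b≤) h)
  preserve-sentence (or φ ψ) pol p n S T g g′ d≤ b≤ (inj₂ h) =
    inj₂ (preserve-sentence ψ pol p n S T g g′ (m⊔n≤o⇒n≤o (depth φ) _ d≤) (m⊔n≤o⇒n≤o (blk pol nothing φ) _ b≤) h)
  preserve-sentence χ@(ex v φ) true (suc p) n S T g g′ d≤ (s≤s b≤) =
    preserve χ true p n S T (noVars-linked _ n S T) g d≤ b≤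
  preserve-sentence χ@(ex v φ) false (suc p) n S T g g′ d≤ (s≤s b≤) =
    preserve χ true p n S T (noVars-linked _ n S T) g d≤ (subst (_≤ p) (blk-dual false false φ) b≤)
  preserve-sentence χ@(all v φ) true (suc p) n S T g g′ d≤ (s≤s b≤) =
    preserve χ false p n T S (noVars-linked _ n T S) g′ d≤ (subst (_≤ p) (blk-dual true false φ) b≤)
  preserve-sentence χ@(all v φ) false (suc p) n S T g g′ d≤ (s≤s b≤) =
    preserve χ false p n T S (noVars-linked _ n T S) g′ d≤ b≤

-- Padding

-- The slot (l , zero) holds the separator of block l, and (l , suc a) the letter a of that block.
Slot : ℕ → ℕ → Set
Slot M k = Fin (suc M) × Fin (suc k)

_<ₗ_ : ∀ {M k} → Slot M k → Slot M k → Set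
_<ₗ_ = ×-Lex _≡_ Fin._<_ Fin._<_

<ₗ-asym : ∀ {M k} {q r : Slot M k} → q <ₗ r → ¬ (r <ₗ q)
<ₗ-asym (inj₁ p)          (inj₁ q)          = <-asym p q
<ₗ-asym (inj₁ p)          (inj₂ (refl , _)) = <-irrefl refl p
<ₗ-asym (inj₂ (refl , _)) (inj₁ q)          = <-irrefl refl q
<ₗ-asym (inj₂ (_ , p))    (inj₂ (_ , q))    = <-asym p q

<ₗ-compare : ∀ {M k} (q r : Slot M k) → q ≡ r ⊎ (q <ₗ r ⊎ r <ₗ q)
<ₗ-compare (l , o) (l′ , o′) with Fin.<-cmp l l′
... | tri< l<l′ _ _ = inj₂ (inj₁ (inj₁ l<l′))
... | tri> _ _ l′<l = inj₂ (inj₂ (inj₁ l′<l))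
... | tri≈ _ refl _ with Fin.<-cmp o o′
...   | tri< o<o′ _ _ = inj₂ (inj₁ (inj₂ (refl , o<o′)))
...   | tri≈ _ refl _ = inj₁ refl
...   | tri> _ _ o′<o = inj₂ (inj₂ (inj₂ (refl , o′<o)))

reverse⁺ : ∀ {A : Set} {R : A → A → Set} {xs} → AllPairs R xs → AllPairs (λ x y → R y x) (reverse xs)
reverse⁺ [] = []
reverse⁺ {xs = x ∷ xs} (p ∷ ps) rewrite unfold-reverse x xs =
  AllPairs.++⁺ (reverse⁺ ps) ([] ∷ []) (All.tabulate λ y∈ → All.lookup p (Any.reverse⁻ y∈) ∷ [])

cartesianProduct⁺ : ∀ {A B : Set} {R : A → A → Set} {Q : B → B → Set} {xs ys} →
                    AllPairs R xs → AllPairs Q ys → AllPairs (×-Lex _≡_ R Q) (cartesianProduct xs ys)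
cartesianProduct⁺ [] qs = []
cartesianProduct⁺ {ys = ys} (p ∷ ps) qs =
  AllPairs.++⁺ (AllPairs.map⁺ (AllPairs.map (λ q → inj₂ (refl , q)) qs)) (cartesianProduct⁺ ps qs)
    (All.map⁺ (All.tabulate λ _ → All.cartesianProduct⁺ (setoid _) (setoid _) _ ys λ x∈ _ → inj₁ (All.lookup p x∈)))

slots : ∀ M k → List (Slot M k)
slots M k = cartesianProduct (allFin (suc M)) (allFin (suc k))

slots-ascending : ∀ M k → AllPairs _<ₗ_ (slots M k)
slots-ascending M k =
  cartesianProduct⁺ (AllPairs.tabulate⁺-< {n = suc M} λ i<j → i<j) (AllPairs.tabulate⁺-< {n = suc k} λ i<j → i<j)

∈-slots : ∀ {M k} (q : Slot M k) → q ∈ slots M k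
∈-slots (l , o) = ∈-cartesianProduct⁺ (∈-allFin l) (∈-allFin o)

data Padded (M k : ℕ) (A : Set) : Set where
  pad : Side → Slot M k → Padded M k A
  mid : A → Padded M k A

-- Slots increase from the centre outwards on both sides, hence `outward` and `inward`. The side
-- conditions are equations, so that matching need not unify `opposite e` with a concrete side.
data PadOrder (M : ℕ) {k : ℕ} (S : Model k) (e : Side) : Padded M k (Carrier S) → Padded M k (Carrier S) → Set where
  outward : ∀ {d q r} → d ≡ e → q <ₗ r → PadOrder M S e (pad d q) (pad d r)
  inward  : ∀ {d q r} → d ≡ opposite e → r <ₗ q → PadOrder M S e (pad d q) (pad d r)
  across  : ∀ {d f q r} → d ≡ opposite e → f ≡ e → PadOrder M S e (pad d q) (pad f r)
  enter   : ∀ {d q x} → d ≡ opposite e → PadOrder M S e (pad d q) (mid x)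
  leave   : ∀ {d q x} → d ≡ e → PadOrder M S e (mid x) (pad d q)
  within  : ∀ {x y} → _≺[_]_ S x e y → PadOrder M S e (mid x) (mid y)

separator : ∀ {k} → Side → Fin (suc (suc k))
separator left  = zero
separator right = suc zero

-- With W the word of all old letters (shifted by two), the word of Pad M S is (W c)ᴹ⁺¹ S (d W)ᴹ⁺¹ for the
-- separators c, d, up to the order of the letters in W; blocks are numbered from the centre outwards.
module _ (M : ℕ) {k : ℕ} (S : Model k) where

  private
    P = Padded M k (Carrier S)

  padLabel : P → Fin (suc (suc k))
  padLabel (pad d (l , zero))  = separator d
  padLabel (pad d (l , suc a)) = suc (suc a)
  padLabel (mid x)             = suc (suc (label S x))

  padReflect : ∀ {e} {x y : P} → PadOrder M S e x y → PadOrder M S (opposite e) y x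
  padReflect {e} (outward refl q<r) = inward (sym (opposite-involutive e)) q<r
  padReflect     (inward p r<q)     = outward p r<q
  padReflect {e} (across p refl)    = across (sym (opposite-involutive e)) p
  padReflect     (enter p)          = leave p
  padReflect {e} (leave refl)       = enter (sym (opposite-involutive e))
  padReflect     (within x≺y)       = within (reflect S x≺y)

  padExclusive : {x y : P} → PadOrder M S left x y → ¬ PadOrder M S right x y
  padExclusive (outward refl q<r) (inward _ r<q)   = <ₗ-asym q<r r<q
  padExclusive (outward refl q<r) (across _ ())
  padExclusive (outward refl q<r) (outward () _)
  padExclusive (inward refl r<q)  (outward _ q<r)  = <ₗ-asym q<r r<q
  padExclusive (inward refl r<q)  (inward () _)
  padExclusive (inward refl r<q)  (across () _)
  padExclusive (across refl refl) (across () _)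
  padExclusive (enter refl)       (enter ())
  padExclusive (leave refl)       (leave ())
  padExclusive (within p)         (within q)       = exclusive S p q

  padCompare : (x y : P) → x ≡ y ⊎ ∃ λ e → PadOrder M S e x y
  padCompare (mid x) (mid y) with compare S x y
  ... | inj₁ refl      = inj₁ refl
  ... | inj₂ (e , x≺y) = inj₂ (e , within x≺y)
  padCompare (mid x)       (pad d q)     = inj₂ (d , leave refl)
  padCompare (pad d q)     (mid x)       = inj₂ (opposite d , enter (sym (opposite-involutive d)))
  padCompare (pad left q)  (pad right r) = inj₂ (right , across refl refl)
  padCompare (pad right q) (pad left r)  = inj₂ (left , across refl refl)
  padCompare (pad left q)  (pad left r) with <ₗ-compare q r
  ... | inj₁ refl       = inj₁ refl
  ... | inj₂ (inj₁ q<r) = inj₂ (left , outward refl q<r)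
  ... | inj₂ (inj₂ r<q) = inj₂ (right , inward refl r<q)
  padCompare (pad right q) (pad right r) with <ₗ-compare q r
  ... | inj₁ refl       = inj₁ refl
  ... | inj₂ (inj₁ q<r) = inj₂ (right , outward refl q<r)
  ... | inj₂ (inj₂ r<q) = inj₂ (left , inward refl r<q)

  private
    lefts mids rights : List P
    lefts  = map (pad left) (reverse (slots M k))
    mids   = map mid (elements S)
    rights = map (pad right) (slots M k)

  padAscending : AllPairs (PadOrder M S right) (lefts ++ mids ++ rights)
  padAscending =
    AllPairs.++⁺ (AllPairs.map⁺ (AllPairs.map (inward refl) (reverse⁺ (slots-ascending M k))))
      (AllPairs.++⁺ (AllPairs.map⁺ (AllPairs.map within (ascending S)))
        (AllPairs.map⁺ (AllPairs.map (outward refl) (slots-ascending M k)))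
        (All.map⁺ (All.universal (λ _ → All.map⁺ (All.universal (λ _ → leave refl) _)) _)))
      (All.map⁺ (All.universal (λ _ → All.++⁺ (All.map⁺ (All.universal (λ _ → enter refl) (elements S)))
                                              (All.map⁺ (All.universal (λ _ → across refl refl) (slots M k)))) _))

  padComplete : ∀ x → x ∈ lefts ++ mids ++ rights
  padComplete (pad left q)  = ∈-++⁺ˡ (∈-map⁺ (pad left) (Any.reverse⁺ (∈-slots q)))
  padComplete (pad right q) = ∈-++⁺ʳ lefts (∈-++⁺ʳ mids (∈-map⁺ (pad right) (∈-slots q)))
  padComplete (mid x)       = ∈-++⁺ʳ lefts (∈-++⁺ˡ (∈-map⁺ mid (complete S x)))

  Pad : Model (suc (suc k))
  Pad = record
    { Carrier   = P
    ; _≺[_]_    = λ x e y → PadOrder M S e x y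
    ; label     = padLabel
    ; reflect   = padReflect
    ; exclusive = padExclusive
    ; compare   = padCompare
    ; elements  = lefts ++ mids ++ rights
    ; ascending = padAscending
    ; complete  = padComplete
    }

-- Padding raises the indistinguishability level

module _ {M k : ℕ} where

  -- Blocks are numbered from 0 to `M`, so this says that at least `n` blocks lie strictly outside
  -- block `l`.
  Deep : ℕ → Fin (suc M) → Set
  Deep n l = toℕ l + n ≤ M

  -- Duplicator's invariant for one block: an answer other than Spoiler's own position still has n full blocks
  -- of padding outside it, so it sees at least as much as Spoiler's position on both sides.
  data Shadow (n : ℕ) (S T : Model k) : Carrier (Pad M S) → Carrier (Pad M T) → Set where
    fixed  : ∀ {d q} → Shadow n S T (pad d q) (pad d q)
    deeper : ∀ {d l l′ o} → l Fin.< l′ → Deep n l′ → Shadow n S T (pad d (l , o)) (pad d (l′ , o))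
    centre : ∀ {x y} → label S x ≡ label T y → Shadow n S T (mid x) (mid y)
    copied : ∀ {d l x} → Deep n l → Shadow n S T (mid x) (pad d (l , suc (label S x)))

  advance : ∀ {n} (l : Fin (suc M)) → Deep (suc n) l →
            Σ (Fin (suc M)) λ l′ → toℕ l′ ≡ suc (toℕ l) × Deep n l′
  advance {n} l deep = fromℕ< l<M , eq′ , subst (λ i → i + n ≤ M) (sym eq′) deep′
    where
    deep′ : suc (toℕ l) + n ≤ M
    deep′ = subst (_≤ M) (+-suc (toℕ l) n) deep
    l<M : suc (toℕ l) < suc M
    l<M = s≤s (≤-trans (m≤m+n _ n) deep′)
    eq′ = Fin.toℕ-fromℕ< l<M

  module _ {S T : Model k} where

    -- A target beyond Duplicator's own block is copied. Any other target is matched by the same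
    -- offset in the next block out, which costs one block of depth for the one move spent.
    reply-outward : ∀ {n d l o} → Deep (suc n) l → ∀ l′ o′ →
      Σ (Carrier (Pad M T)) λ y → PadOrder M T d (pad d (l , o)) y × Shadow n S T (pad d (l′ , o′)) y
    reply-outward {l = l} deep l′ o′ with toℕ l <? toℕ l′
    ... | yes l<l′ = _ , outward refl (inj₁ l<l′) , fixed
    ... | no  l≮l′ =
      let l″ , l″≡ , deep″ = advance l deep
      in pad _ (l″ , o′) , outward refl (inj₁ (≤-reflexive (sym l″≡))) ,
         deeper (≤-trans (s≤s (≮⇒≥ l≮l′)) (≤-reflexive (sym l″≡))) deep″

    reply-inward : ∀ {l l′ r : Fin (suc M)} {o o′ : Fin (suc k)} → l Fin.< l′ → (r , o′) <ₗ (l , o) → r Fin.< l′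
    reply-inward l<l′ (inj₁ r<l)        = <-trans r<l l<l′
    reply-inward l<l′ (inj₂ (refl , _)) = l<l′

    -- Within the last block Spoiler moves in `S` only. Padding targets are copied or matched
    -- further out, and middle targets are answered by an equal letter in the padding, so no reply
    -- falls in the middle of `T`.
    shadow-move : ∀ {n} → n ≤ M → ∀ {x y} → Shadow (suc n) S T x y → ∀ e x′ → PadOrder M S e x x′ →
                  Σ (Carrier (Pad M T)) λ y′ → PadOrder M T e y y′ × Shadow n S T x′ y′
    shadow-move n≤M fixed e (pad _ _) (outward p q<r) = _ , outward p q<r , fixed
    shadow-move n≤M fixed e (pad _ _) (inward p r<q)  = _ , inward p r<q , fixed
    shadow-move n≤M fixed e (pad _ _) (across p q)    = _ , across p q , fixed
    -- Block 0 on the far side contains every old letter and has `M` blocks outside it, so `n≤M` is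
    -- exactly its depth.
    shadow-move n≤M fixed e (mid x)   (enter p)       = pad e (zero , _) , across p refl , copied n≤M
    shadow-move n≤M (deeper l<l′ deep) e (pad _ (r , o)) (outward refl _) = reply-outward deep r o
    shadow-move n≤M (deeper l<l′ deep) e (pad _ _) (inward p r<q) =
      _ , inward p (inj₁ (reply-inward l<l′ r<q)) , fixed
    shadow-move n≤M (deeper l<l′ deep) e (pad _ _) (across p q) = _ , across p q , fixed
    shadow-move n≤M (deeper l<l′ deep) e (mid x) (enter p) = pad e (zero , _) , across p refl , copied n≤M
    shadow-move n≤M (centre _) e (pad _ _) (leave p)  = _ , leave p , fixed
    shadow-move n≤M (centre _) e (mid x)   (within _) = pad e (zero , _) , leave refl , copied n≤M
    shadow-move n≤M (copied {left} deep)  left  (pad _ (r , o)) (leave refl) = reply-outward deep r o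
    shadow-move n≤M (copied {left} deep)  right (pad _ _)       (leave refl) = _ , across refl refl , fixed
    shadow-move n≤M (copied {right} deep) left  (pad _ _)       (leave refl) = _ , across refl refl , fixed
    shadow-move n≤M (copied {right} deep) right (pad _ (r , o)) (leave refl) = reply-outward deep r o
    -- Moving on within the middle, towards the side that holds the copy, pushes the copy one block
    -- outwards; the opposite direction jumps across to block 0 there.
    shadow-move n≤M (copied {left} {l} deep)  left  (mid x) (within _) =
      let l′ , l′≡ , deep′ = advance l deep in _ , outward refl (inj₁ (≤-reflexive (sym l′≡))) , copied deep′
    shadow-move n≤M (copied {left} deep)  right (mid x) (within _) =
      pad right (zero , _) , across refl refl , copied n≤M
    shadow-move n≤M (copied {right} deep) left  (mid x) (within _) =
      pad left (zero , _) , across refl refl , copied n≤M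
    shadow-move n≤M (copied {right} {l} deep) right (mid x) (within _) =
      let l′ , l′≡ , deep′ = advance l deep in _ , outward refl (inj₁ (≤-reflexive (sym l′≡))) , copied deep′

    shadow-label : ∀ {n x y} → Shadow n S T x y → label (Pad M T) y ≡ label (Pad M S) x
    shadow-label (fixed {q = _ , zero})    = refl
    shadow-label (fixed {q = _ , suc _})   = refl
    shadow-label (deeper {o = zero} _ _)   = refl
    shadow-label (deeper {o = suc _} _ _)  = refl
    shadow-label (centre p)                = cong (λ a → suc (suc a)) (sym p)
    shadow-label (copied _)                = refl

    shadow-simulates : ∀ n → n ≤ M → ∀ {x y} → Shadow n S T x y → Simulates 1 n (Pad M S) (Pad M T) x y
    shadow-simulates zero    n≤M h = shadow-label h
    shadow-simulates (suc n) n≤M h =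
      (λ e x′ x≺x′ → let y′ , y≺y′ , h′ = shadow-move n≤M′ h e x′ x≺x′
                     in y′ , y≺y′ , shadow-simulates n n≤M′ h′)
      , shadow-label h
      where n≤M′ = ≤-trans (n≤1+n n) n≤M

  data Aligned (p n : ℕ) (S T : Model k) : Carrier (Pad M S) → Carrier (Pad M T) → Set where
    padding : ∀ {d q} → Aligned p n S T (pad d q) (pad d q)
    middle  : ∀ {x y} → Simulates p n S T x y → Aligned p n S T (mid x) (mid y)

  aligned-swap : ∀ {p n} {S T : Model k} {x y} → Aligned (suc p) n S T x y → Aligned p n T S y x
  aligned-swap                 padding    = padding
  aligned-swap {p} {n} {S} {T} (middle h) = middle (simulates-swap p n S T h)

  -- The hand-over to the last block: an old game without blocks guarantees equal labels only, which
  -- is all that `centre` asks for.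
  aligned-shadow : ∀ {n} {S T : Model k} {x y} → Aligned 0 n S T x y → Shadow n S T x y
  aligned-shadow padding    = fixed
  aligned-shadow (middle p) = centre p

  aligned-move : ∀ p n (S T : Model k) {x y} → GloballySimulates (suc p) (suc n) S T → Aligned (suc p) (suc n) S T x y →
                 ∀ e x′ → PadOrder M S e x x′ →
                 Σ (Carrier (Pad M T)) λ y′ → PadOrder M T e y y′ × Aligned (suc p) n S T x′ y′
  aligned-move p n S T g padding e (pad _ _) (outward p′ q<r) = _ , outward p′ q<r , padding
  aligned-move p n S T g padding e (pad _ _) (inward p′ r<q)  = _ , inward p′ r<q , padding
  aligned-move p n S T g padding e (pad _ _) (across p′ q)    = _ , across p′ q , padding
  -- Entering the middle from the padding is an opening move of the old game, since every middle
  -- position lies on the same side of the padding pebble.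
  aligned-move p n S T (g , _) padding e (mid x) (enter p′) =
    let y , h = g x in mid y , enter p′ , middle (simulates-pred (suc p) n S T h)
  aligned-move p n S T g (middle h) e (pad _ _) (leave p′) = _ , leave p′ , padding
  aligned-move p n S T g (middle (f , _)) e (mid x) (within x≺x′) =
    let y′ , y≺y′ , h′ = f e x x≺x′ in mid y′ , within y≺y′ , middle h′

  -- The old game has one block fewer than the new one. Once its blocks are used up, the remaining
  -- block is played with `Shadow`.
  aligned-simulates : ∀ p n → n ≤ M → ∀ (S T : Model k) {x y} → GloballySimulates p n S T → Aligned p n S T x y →
                      Simulates (suc p) n (Pad M S) (Pad M T) x y
  aligned-simulates zero n n≤M S T g h = shadow-simulates n n≤M (aligned-shadow h)
  aligned-simulates (suc p) zero n≤M S T (_ , g) h = aligned-simulates p zero n≤M T S g (aligned-swap h)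
  aligned-simulates (suc p) (suc n) n≤M S T g h =
    (λ e x′ x≺x′ → let y′ , y≺y′ , h′ = aligned-move p n S T g h e x′ x≺x′
                   in y′ , y≺y′ ,
                      aligned-simulates (suc p) n (≤-trans (n≤1+n n) n≤M) S T (globally-pred (suc p) n S T g) h′)
    , aligned-simulates p (suc n) n≤M T S (proj₂ g) (aligned-swap h)

  Pad-simulates : ∀ p n → n ≤ M → ∀ (S T : Model k) → GloballySimulates p n S T →
                  GloballySimulates (suc p) n (Pad M S) (Pad M T)
  Pad-simulates zero n n≤M S T g = respond′ , tt
    where
    respond′ : ∀ x → Σ (Carrier (Pad M T)) λ y → Simulates 1 n (Pad M S) (Pad M T) x y
    respond′ (pad d q) = pad d q , shadow-simulates n n≤M fixed
    -- The middle of `T` may be empty, so the letter is looked up in the padding.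
    respond′ (mid x)   = pad left (zero , suc (label S x)) , shadow-simulates n n≤M (copied n≤M)
  Pad-simulates (suc p) n n≤M S T g = respond′ , Pad-simulates p n n≤M T S (proj₂ g)
    where
    respond′ : ∀ x → Σ (Carrier (Pad M T)) λ y → Simulates (suc (suc p)) n (Pad M S) (Pad M T) x y
    respond′ (pad d q) = pad d q , aligned-simulates (suc p) n n≤M S T g padding
    respond′ (mid x)   =
      let y , h = proj₁ g x in mid y , aligned-simulates (suc p) n n≤M S T g (middle h)

-- Relativisation to the middle of a padded model

-- Only `v` is free, so the other variable can be requantified even while in use, and relativisation
-- stays within two variables. The negated `lt` expresses "at or after" and "at or before".
central : ∀ {k s} v → Bound s v → FO2 (suc (suc k)) s
central v b = neg (ex (other v)
  (or (and (neg (lt (other v) v (bound-new (other v)) (bound-old (other v) v b)))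
           (lab (separator left) (other v) (bound-new (other v))))
      (and (neg (lt v (other v) (bound-old (other v) v b) (bound-new (other v))))
           (lab (separator right) (other v) (bound-new (other v))))))

relativise : ∀ {k s} → FO2 k s → FO2 (suc (suc k)) s
relativise tt′            = tt′
relativise ff′            = ff′
relativise (lab a v b)    = lab (suc (suc a)) v b
relativise (lt u v bu bv) = lt u v bu bv
relativise (eq u v bu bv) = eq u v bu bv
relativise (neg φ)        = neg (relativise φ)
relativise (and φ ψ)      = and (relativise φ) (relativise ψ)
relativise (or φ ψ)       = or (relativise φ) (relativise ψ)
relativise (ex v φ)       = ex v (and (central v (bound-new v)) (relativise φ))
relativise (all v φ)      = all v (or (neg (central v (bound-new v))) (relativise φ))

-- The 1 is the block of central, which always opens a new one: below ∃ it occurs positively, below ∀ negatively.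
quantified : ∀ a {b c} → b ≤ suc c → a + (1 ⊔ b) ≤ suc (a + c)
quantified a {b} {c} b≤ = ≤-trans (+-monoʳ-≤ a (⊔-lub (s≤s z≤n) b≤)) (≤-reflexive (+-suc a c))

-- The guards do not accumulate: a path that enters `central` ends there, so every path gains at
-- most one block however many quantifiers are relativised.
blk-relativise : ∀ {k s} pol q (φ : FO2 k s) → blk pol q (relativise φ) ≤ suc (blk pol q φ)
blk-relativise pol q tt′            = z≤n
blk-relativise pol q ff′            = z≤n
blk-relativise pol q (lab _ _ _)    = z≤n
blk-relativise pol q (lt _ _ _ _)   = z≤n
blk-relativise pol q (eq _ _ _ _)   = z≤n
blk-relativise pol q (neg φ)        = blk-relativise (flip pol) q φ
blk-relativise pol q (and φ ψ)      = ⊔-mono-≤ (blk-relativise pol q φ) (blk-relativise pol q ψ)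
blk-relativise pol q (or φ ψ)       = ⊔-mono-≤ (blk-relativise pol q φ) (blk-relativise pol q ψ)
blk-relativise true  q (ex _ φ)     = quantified (newBlock q true) (blk-relativise true (just true) φ)
blk-relativise false q (ex _ φ)     = quantified (newBlock q false) (blk-relativise false (just false) φ)
blk-relativise true  q (all _ φ)    = quantified (newBlock q false) (blk-relativise true (just false) φ)
blk-relativise false q (all _ φ)    = quantified (newBlock q true) (blk-relativise false (just true) φ)

module _ {M k : ℕ} {S : Model k} where

  private
    P = Padded M k (Carrier S)

  Outside : P → Set
  Outside x = Σ P λ y → (¬ PadOrder M S right y x × padLabel M S y ≡ separator left)
                      ⊎ (¬ PadOrder M S right x y × padLabel M S y ≡ separator right)

  mid-inside : ∀ x → ¬ Outside (mid x)
  mid-inside x (pad left (_ , zero) , inj₁ (h , _))   = h (enter refl)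
  mid-inside x (pad right (_ , zero) , inj₂ (h , _))  = h (leave refl)
  mid-inside x (pad right (_ , zero) , inj₁ (_ , ()))
  mid-inside x (pad left (_ , zero) , inj₂ (_ , ()))
  mid-inside x (pad d (_ , suc a) , inj₁ (_ , ()))
  mid-inside x (pad d (_ , suc a) , inj₂ (_ , ()))
  mid-inside x (mid y , inj₁ (_ , ()))
  mid-inside x (mid y , inj₂ (_ , ()))

  pad-outside : ∀ d q → Outside (pad d q)
  -- The innermost separator is the least slot, so every padding position on its side is equal to it
  -- or further out.
  pad-outside left q = pad left (zero , zero) , inj₁ (innermost , refl)
    where
    innermost : ¬ PadOrder M S right (pad left (zero , zero)) (pad left q)
    innermost (inward _ (inj₂ (_ , ())))
    innermost (across _ ())
  pad-outside right q = pad right (zero , zero) , inj₂ (innermost , refl)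
    where
    innermost : ¬ PadOrder M S right (pad right q) (pad right (zero , zero))
    innermost (outward _ (inj₂ (_ , ())))
    innermost (across () _)

  central⇒inside : ∀ {s} (ρ : Assignment (Pad M S) s) v b → Holds (Pad M S) ρ (central v b) → ¬ Outside (ρ v b)
  central⇒inside ρ vx b h = h
  central⇒inside ρ vy b h = h

  inside⇒central : ∀ {s} (ρ : Assignment (Pad M S) s) v b → ¬ Outside (ρ v b) → Holds (Pad M S) ρ (central v b)
  inside⇒central ρ vx b h = h
  inside⇒central ρ vy b h = h

  update-new : ∀ {s} (ρ : Assignment (Pad M S) s) v x → update (Pad M S) ρ v x v (bound-new v) ≡ x
  update-new ρ vx x = refl
  update-new ρ vy x = refl

  mid-central : ∀ {s} (ρ : Assignment (Pad M S) s) v x →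
                Holds (Pad M S) (update (Pad M S) ρ v (mid x)) (central v (bound-new v))
  mid-central ρ v x = inside⇒central _ v (bound-new v)
    λ h → mid-inside x (subst Outside (update-new ρ v (mid x)) h)

  pad-not-central : ∀ {s} (ρ : Assignment (Pad M S) s) v d q →
                    ¬ Holds (Pad M S) (update (Pad M S) ρ v (pad d q)) (central v (bound-new v))
  pad-not-central ρ v d q h = central⇒inside _ v (bound-new v) h
    (subst Outside (sym (update-new ρ v (pad d q))) (pad-outside d q))

  Centred : ∀ {s} → Assignment (Pad M S) s → Assignment S s → Set
  Centred ρ σ = ∀ v b → ρ v b ≡ mid (σ v b)

  centred-update : ∀ {s} {ρ : Assignment (Pad M S) s} {σ : Assignment S s} → Centred ρ σ →
                   ∀ v x → Centred (update (Pad M S) ρ v (mid x)) (update S σ v x)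
  centred-update c vx x vx b = refl
  centred-update c vx x vy b = c vy b
  centred-update c vy x vx b = c vx b
  centred-update c vy x vy b = refl

  mid-injective : ∀ {x y : Carrier S} → _≡_ {A = P} (mid x) (mid y) → x ≡ y
  mid-injective refl = refl

  mutual
    relativise-sound : ∀ {s} {ρ : Assignment (Pad M S) s} {σ : Assignment S s} → Centred ρ σ →
                       ∀ φ → Holds (Pad M S) ρ (relativise φ) → Holds S σ φ
    relativise-sound c tt′ h = h
    relativise-sound c (lab a v b) h rewrite c v b = Fin.suc-injective (Fin.suc-injective h)
    relativise-sound c (lt u v bu bv) h rewrite c u bu | c v bv with h
    ... | within x≺y = x≺y
    relativise-sound c (eq u v bu bv) h rewrite c u bu | c v bv = mid-injective h
    relativise-sound c (neg φ) h h′ = h (relativise-complete c φ h′)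
    relativise-sound c (and φ ψ) (h , h′) = relativise-sound c φ h , relativise-sound c ψ h′
    relativise-sound c (or φ ψ) (inj₁ h) = inj₁ (relativise-sound c φ h)
    relativise-sound c (or φ ψ) (inj₂ h) = inj₂ (relativise-sound c ψ h)
    relativise-sound c (ex v φ) (mid x , _ , h) = x , relativise-sound (centred-update c v x) φ h
    relativise-sound {ρ = ρ} c (ex v φ) (pad d q , h , _) = ⊥-elim (pad-not-central ρ v d q h)
    relativise-sound {ρ = ρ} c (all v φ) h x with h (mid x)
    ... | inj₁ h′ = ⊥-elim (h′ (mid-central ρ v x))
    ... | inj₂ h′ = relativise-sound (centred-update c v x) φ h′

    relativise-complete : ∀ {s} {ρ : Assignment (Pad M S) s} {σ : Assignment S s} → Centred ρ σ →
                          ∀ φ → Holds S σ φ → Holds (Pad M S) ρ (relativise φ)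
    relativise-complete c tt′ h = h
    relativise-complete c (lab a v b) h rewrite c v b = cong (λ a → suc (suc a)) h
    relativise-complete c (lt u v bu bv) h rewrite c u bu | c v bv = within h
    relativise-complete c (eq u v bu bv) h rewrite c u bu | c v bv = cong mid h
    relativise-complete c (neg φ) h h′ = h (relativise-sound c φ h′)
    relativise-complete c (and φ ψ) (h , h′) = relativise-complete c φ h , relativise-complete c ψ h′
    relativise-complete c (or φ ψ) (inj₁ h) = inj₁ (relativise-complete c φ h)
    relativise-complete c (or φ ψ) (inj₂ h) = inj₂ (relativise-complete c ψ h)
    relativise-complete {ρ = ρ} c (ex v φ) (x , h) =
      mid x , mid-central ρ v x , relativise-complete (centred-update c v x) φ h
    relativise-complete c (all v φ) h (mid x) = inj₂ (relativise-complete (centred-update c v x) φ (h x))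
    relativise-complete {ρ = ρ} c (all v φ) h (pad d q) = inj₁ (pad-not-central ρ v d q)

-- The hierarchy

empty : Model 1
empty = record
  { Carrier = ⊥ ; _≺[_]_ = λ _ _ _ → ⊥ ; label = λ () ; reflect = λ () ; exclusive = λ () ; compare = λ ()
  ; elements = [] ; ascending = [] ; complete = λ () }

singleton : Model 1
singleton = record
  { Carrier = ⊤ ; _≺[_]_ = λ _ _ _ → ⊥ ; label = λ _ → zero ; reflect = λ () ; exclusive = λ ()
  ; compare = λ _ _ → inj₁ refl ; elements = [ tt ] ; ascending = [] ∷ [] ; complete = λ _ → here refl }

alphabet : ℕ → ℕ
alphabet zero    = 1
alphabet (suc m) = suc (suc (alphabet m))

padTimes : ℕ → (m : ℕ) → Model 1 → Model (alphabet m)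
padTimes M zero    S = S
padTimes M (suc m) S = Pad M (padTimes M m S)

-- Each round of padding buys one block, starting from zero blocks, for which there is nothing to
-- prove.
padTimes-simulates : ∀ M m (S T : Model 1) → GloballySimulates m M (padTimes M m S) (padTimes M m T)
padTimes-simulates M zero    S T = tt
padTimes-simulates M (suc m) S T =
  Pad-simulates m M ≤-refl (padTimes M m S) (padTimes M m T) (padTimes-simulates M m S T)

coreNonempty : (m : ℕ) → Sentence (alphabet m)
coreNonempty zero    = ex vx tt′
coreNonempty (suc m) = relativise (coreNonempty m)

blocks-coreNonempty : ∀ m → blocks (coreNonempty m) ≤ suc m
blocks-coreNonempty zero    = ≤-refl
blocks-coreNonempty (suc m) =
  ≤-trans (blk-relativise true nothing (coreNonempty m)) (s≤s (blocks-coreNonempty m))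

singleton-core : ∀ M m → padTimes M m singleton ⊩ coreNonempty m
singleton-core M zero    = tt , tt
singleton-core M (suc m) =
  relativise-complete (λ { vx () ; vy () }) (coreNonempty m) (singleton-core M m)

empty-core : ∀ M m → ¬ (padTimes M m empty ⊩ coreNonempty m)
empty-core M zero    (() , _)
empty-core M (suc m) h =
  empty-core M m (relativise-sound (λ { vx () ; vy () }) (coreNonempty m) h)

-- The languages are fixed before `ψ` is given, so they contain the padded words for all `M`;
-- whatever the depth of `ψ`, a large enough padding is available.
padLang : (m : ℕ) → Model 1 → Lang (alphabet m)
padLang m S w = ∃ λ M → w ≡ word (padTimes M m S)

coreNonempty-separates : ∀ m → Separates (coreNonempty m) (padLang m singleton) (padLang m empty)
coreNonempty-separates m = inj₁
  ( (λ { _ (M , refl) → ⊩⇒⊨ (padTimes M m singleton) (coreNonempty m) (singleton-core M m) })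
  , (λ { _ (M , refl) h → empty-core M m (⊨⇒⊩ (padTimes M m empty) (coreNonempty m) h) }))

padTimes-preserves : ∀ m (ψ : Sentence (alphabet m)) → InFO2 m ψ → ∀ S T →
                     word (padTimes (depth ψ) m S) ⊨ ψ → word (padTimes (depth ψ) m T) ⊨ ψ
padTimes-preserves m ψ ψ∈ S T h =
  ⊩⇒⊨ (padTimes M m T) ψ
    (preserve-sentence ψ true m M (padTimes M m S) (padTimes M m T)
      (padTimes-simulates M m S T) (padTimes-simulates M m T S) ≤-refl ψ∈
      (⊨⇒⊩ (padTimes M m S) ψ h))
  where M = depth ψ

padLang-inseparable : ∀ m (ψ : Sentence (alphabet m)) → InFO2 m ψ → ∀ S T →
                      ¬ Separates ψ (padLang m S) (padLang m T)
padLang-inseparable m ψ ψ∈ S T (inj₁ (K⊨ , L⊭)) =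
  L⊭ _ (depth ψ , refl) (padTimes-preserves m ψ ψ∈ S T (K⊨ _ (depth ψ , refl)))
padLang-inseparable m ψ ψ∈ S T (inj₂ (L⊨ , K⊭)) =
  K⊭ _ (depth ψ , refl) (padTimes-preserves m ψ ψ∈ T S (L⊨ _ (depth ψ , refl)))

theorem4p11 : (m : ℕ) → 1 ≤ m →
    Σ ℕ λ k → Σ (Lang k) λ K → Σ (Lang k) λ L → Σ (Sentence k) λ φ →
    InFO2 m φ × Separates φ K L
    × ((ψ : Sentence k) → InFO2 (m ∸ 1) ψ → ¬ Separates ψ K L)
theorem4p11 (suc m) _ =
  -- One block is spent on the bare statement that a position exists, so `m` rounds of padding give
  -- a sentence with `suc m` blocks.
  alphabet m , padLang m singleton , padLang m empty , coreNonempty m ,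
  blocks-coreNonempty m , coreNonempty-separates m ,
  λ ψ ψ∈ → padLang-inseparable m ψ ψ∈ singleton empty
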